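{- Let $S$ be a set of shapes, $G=(V_G,E_G)$ an RDF data graph, and $\sigma$ an assignment that is faithful with respect to $S$ and $G$. Let $K^{S}=\tau_{\mathrm{shapes}}(S)$ be the description logic knowledge base constructed from $S$. Then the interpretation $I^{G,\sigma}$ constructed from $G$ and $\sigma$ is a finite model of $K^{S}$; that is, its universe is finite and $I^{G,\sigma}\models K^{S}$.
   Context: **RDF graphs.** $\mathcal V$ is the set of all graph nodes, $\mathcal V_C\subseteq\mathcal V$ the set of RDF classes. An RDF (data) graph is $G=(V_G,E_G)$ with $V_G\subseteq\mathcal V$ a finite set of nodes and $E_G$ a set of triples $(v_1,p,v_2)$, meaning an edge from $v_1$ to $v_2$ labeled with property $p$. The property $\mathtt{type}$ is used to indicate class membership. **Constraints.** Let $\mathcal N_S$ be the set of shape names. Constraints $\phi$ and path expressions $\rho$ are given by $\phi ::= \top \mid s \mid v \mid \phi_1\land\phi_2 \mid \neg\phi \mid\ \geqslant_n\rho.\phi$ and $\rho ::= p \mid \hat{\ }\rho \mid \rho_1/\rho_2$, where $s\in\mathcal N_S$, $v\in\mathcal V$, $p$ is a property. ($\lor,\leqslant_n,=_n,\forall$ are derived as usual.) **Shapes.** A shape is a triple $(s,\phi,q)$ of a shape name, a constraint and a target query $q ::= \bot \mid \{v_1,\dots,v_n\} \mid \mathtt{class}\ v \mid \mathtt{subjectsOf}\ p \mid \mathtt{objectsOf}\ p$, with $v_i\in\mathcal V$ and $v\in\mathcal V_C$. For a set of shapes $S$, $\mathrm{Names}(S)$ is its set of shape names; whenever $(s,\phi,q)\in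 S$ and a shape name $s'$ appears in $\phi$, some $(s',\phi',q')\in S$ exists. **Evaluation.** An assignment for $G$ and $S$ is a total function $\sigma:V_G\to 2^{\mathrm{Names}(S)}$. Paths: $\llbracket p\rrbracket^G=\{(v_1,v_2)\mid (v_1,p,v_2)\in E_G\}$; $\llbracket\hat{\ }\rho\rrbracket^G=\{(v_2,v_1)\mid(v_1,v_2)\in\llbracket\rho\rrbracket^G\}$; $\llbracket\rho_1/\rho_2\rrbracket^G=\{(v_1,v_2)\mid\exists v:(v_1,v)\in\llbracket\rho_1\rrbracket^G\land(v,v_2)\in\llbracket\rho_2\rrbracket^G\}$. Constraints at a node $v$: $\llbracket\top\rrbracket^{v,G,\sigma}$ is true; $\llbracket s\rrbracket^{v,G,\sigma}$ is true iff $s\in\sigma(v)$; $\llbracket v'\rrbracket^{v,G,\sigma}$ is true iff $v=v'$; $\land,\neg$ are Boolean; $\llbracket\geqslant_n\rho.\phi\rrbracket^{v,G,\sigma}$ is true iff $|\{v_2\mid(v,v_2)\in\llbracket\rho\rrbracket^G\land\llbracket\phi\rrbracket^{v_2,G,\sigma}\text{ true}\}|\ge n$. Target queries: $\llbracket\bot\rrbracket_G=\emptyset$; $\llbracket\{v_1,\dots,v_n\}\rrbracket_G=\{v_1,\dots,v_n\}$; $\llbracket\mathtt{class}\ v_2\rrbracket_G=\{v_1\mid(v_1,\mathtt{type},v_2)\in E_G\}$; $\llbracket\mathtt{subjectsOf}\ p\rrbracket_G=\{v_1\mid\exists v_2:(v_1,p,v_2)\in E_G\}$; $\llbracket\mathtt{objectsOf}\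 p\rrbracket_G=\{v_2\mid\exists v_1:(v_1,p,v_2)\in E_G\}$. **Faithful assignment.** $\sigma$ is faithful with respect to $S$ and $G$ iff for each $(s,\phi,q)\in S$: (i) for every $v\in V_G$, $s\in\sigma(v)\Leftrightarrow\llbracket\phi\rrbracket^{v,G,\sigma}$ is true; (ii) every $v\in\llbracket q\rrbracket_G$ occurs in $V_G$ and satisfies $s\in\sigma(v)$. **Description logic.** A knowledge base $K$ is a set of axioms over a signature $(N_A,N_P,N_O)$ of atomic concept names, atomic property names and object names. Roles: $r ::= p\mid r^-\mid r_1\circ r_2$ (inverse, relational composition). Concepts: $C ::= A\mid\{o_1,\dots,o_n\}\mid\top\mid\neg C\mid C\sqcap D\mid\ \geq_n r.C$; $\bot:=\neg\top$, $\exists r.C:=\ \geq_1 r.C$. An interpretation $I=(\Delta^I,\cdot^I)$ has a non-empty universe and gives $o^I\in\Delta^I$, $A^I\subseteq\Delta^I$, $p^I\subseteq\Delta^I\times\Delta^I$, extended by the standard set-theoretic semantics, with $(\geq_n r.C)^I=\{o_1\mid|\{o_2\mid(o_1,o_2)\in r^I\land o_2\in C^I\}|\ge n\}$. $I\models C\sqsubseteq D$ iff $C^I\subseteq D^I$; $C\equiv D$ abbreviates $C\sqsubseteq D$ and $D\sqsubseteq C$. $I$ is a model of $K$ ($I\models K$) if it satisfies all axioms of $K$; it is finite if $\Delta^I$ is finite. **Translation.** $\tau_{\mathrm{name}}$ is an injective function sending shape names and RDF classes to atomic concept names, graph nodes to object names, and properties to atomic property names; $\tau_{\mathrm{node}}$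 is its inverse. Further: $\tau_{\mathrm{role}}(p)=\tau_{\mathrm{name}}(p)$, $\tau_{\mathrm{role}}(\hat{\ }\rho)=\tau_{\mathrm{role}}(\rho)^-$, $\tau_{\mathrm{role}}(\rho_1/\rho_2)=\tau_{\mathrm{role}}(\rho_1)\circ\tau_{\mathrm{role}}(\rho_2)$; $\tau_{\mathrm{constr}}(\top)=\top$, $\tau_{\mathrm{constr}}(s)=\tau_{\mathrm{name}}(s)$, $\tau_{\mathrm{constr}}(v)=\{\tau_{\mathrm{name}}(v)\}$, $\tau_{\mathrm{constr}}(\phi_1\land\phi_2)=\tau_{\mathrm{constr}}(\phi_1)\sqcap\tau_{\mathrm{constr}}(\phi_2)$, $\tau_{\mathrm{constr}}(\neg\phi)=\neg\tau_{\mathrm{constr}}(\phi)$, $\tau_{\mathrm{constr}}(\geqslant_n\rho.\phi)=\ \geq_n\tau_{\mathrm{role}}(\rho).\tau_{\mathrm{constr}}(\phi)$; $\tau_{\mathrm{target}}(\bot)=\bot$, $\tau_{\mathrm{target}}(\{v_1,\dots,v_n\})=\{\tau_{\mathrm{name}}(v_1),\dots,\tau_{\mathrm{name}}(v_n)\}$, $\tau_{\mathrm{target}}(\mathtt{class}\ v)=\tau_{\mathrm{name}}(v)$ (the atomic concept of the class $v$), $\tau_{\mathrm{target}}(\mathtt{subjectsOf}\ p)=\exists\tau_{\mathrm{name}}(p).\top$, $\tau_{\mathrm{target}}(\mathtt{objectsOf}\ p)=\exists\tau_{\mathrm{name}}(p)^-.\top$; $\tau_{\mathrm{shapes}}(S)=\bigcup_{(s,\phi,q)\in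 S}\{\tau_{\mathrm{target}}(q)\sqsubseteq\tau_{\mathrm{name}}(s),\ \tau_{\mathrm{constr}}(\phi)\equiv\tau_{\mathrm{name}}(s)\}$. **The interpretation $I^{G,\sigma}$.** The set of object names is the one obtained from the graph, $N_O=\{\tau_{\mathrm{name}}(v)\mid v\in V_G\}$ (so the object names used in $K^S$ are names of nodes of $G$), and the universe is $N_O$. Writing $I=I^{G,\sigma}$: (1) $o^I=o$ for all $o\in N_O$; (2) for $p\in N_P$: $(o_1^I,o_2^I)\in p^I$ iff $(\tau_{\mathrm{node}}(o_1),\tau_{\mathrm{node}}(p),\tau_{\mathrm{node}}(o_2))\in E_G\setminus\{(v_1,\mathtt{type},v_2)\in E_G\}$; (3) for an atomic concept name $A_v$ of an RDF class: $o^I\in A_v^I$ iff $(\tau_{\mathrm{node}}(o),\mathtt{type},\tau_{\mathrm{node}}(A_v))\in E_G$; (4) for an atomic concept name $A_s$ of a shape name: $o^I\in A_s^I$ iff $\tau_{\mathrm{node}}(A_s)\in\sigma(\tau_{\mathrm{node}}(o))$.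
   Formalization: It is additionally assumed that the property type occurs in no path expression of a constraint of S (otherwise the claim fails, since the interpretation drops type edges from the roles), and that V_G is non-empty, so that the interpretation has a non-empty universe. -}

module Defs where

open import Data.Empty using () renaming (⊥ to False)
open import Data.Fin using (Fin)
open import Data.List using (List; []; _∷_; [_])
import Data.List as List
open import Data.List.Membership.Propositional using () renaming (_∈_ to _∈ᴸ_)
open import Data.List.Relation.Unary.Unique.Propositional using (Unique)
open import Data.Nat using (ℕ)
open import Data.Product using (∃; ∃-syntax; _×_; _,_; proj₁; proj₂)
open import Data.Refinement using (Refinement; value)
open import Data.Sum using (_⊎_; inj₁; inj₂)
open import Data.Unit using () renaming (⊤ to True)
open import Function using (Injective; flip; _↔_; _⇔_)
open import Level using (0ℓ)
open import Relation.Binary using (Rel)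
open import Relation.Binary.PropositionalEquality using (_≡_; _≢_; refl)
open import Relation.Nullary using () renaming (¬_ to Not)
open import Relation.Unary using (Pred; _∈_; _⊆_; _∩_)

-- |P| ≥ n; also meaningful when P is infinite.
AtLeast : {X : Set} → ℕ → Pred X 0ℓ → Set
AtLeast {X} n P =
  ∃[ f ] (Injective {A = Fin n} {B = X} _≡_ _≡_ f × (∀ i → f i ∈ P))

Finite : Set → Set
Finite X = ∃[ n ] (X ↔ Fin n)

record Vocabulary : Set₁ where
  field
    Node      : Set
    IsClass   : Pred Node 0ℓ
    Property  : Set
    type      : Property
    ShapeName : Set

  -- A class is determined by its node: the membership proof is irrelevant.
  Class : Set
  Class = Refinement Node IsClass

open Vocabulary

record Graph (𝒱 : Vocabulary) : Set₁ where
  field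
    -- The finite set V_G, listed without repetition.
    nodes   : List (Node 𝒱)
    unique  : Unique nodes
    E       : Pred (Node 𝒱 × Property 𝒱 × Node 𝒱) 0ℓ
    E-nodes : ∀ {v₁ p v₂} → E (v₁ , p , v₂) → v₁ ∈ᴸ nodes × v₂ ∈ᴸ nodes

  -- Membership in a repetition-free list is a proposition, so two elements
  -- of V are equal as soon as the underlying nodes are.
  V : Set
  V = ∃[ v ] v ∈ᴸ nodes

open Graph

module _ (𝒱 : Vocabulary) where

  infixl 7 _/_
  infixr 6 _∧_

  data Path : Set where
    prop : Property 𝒱 → Path
    ^_   : Path → Path
    _/_  : Path → Path → Path

  data Constraint : Set where
    ⊤     : Constraint
    shape : ShapeName 𝒱 → Constraint
    node  : Node 𝒱 → Constraint
    _∧_   : Constraint → Constraint → Constraint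
    ¬_    : Constraint → Constraint
    ⩾     : ℕ → Path → Constraint → Constraint

  data Query : Set where
    ⊥          : Query
    oneOf      : List (Node 𝒱) → Query
    class      : Class 𝒱 → Query
    subjectsOf : Property 𝒱 → Query
    objectsOf  : Property 𝒱 → Query

  Shape : Set
  Shape = ShapeName 𝒱 × Constraint × Query

module _ {𝒱 : Vocabulary} where

  NameOccurs : ShapeName 𝒱 → Constraint 𝒱 → Set
  NameOccurs s ⊤         = False
  NameOccurs s (shape t) = s ≡ t
  NameOccurs s (node v)  = False
  NameOccurs s (φ ∧ ψ)   = NameOccurs s φ ⊎ NameOccurs s ψ
  NameOccurs s (¬ φ)     = NameOccurs s φ
  NameOccurs s (⩾ n ρ φ) = NameOccurs s φ

  OnPath : Property 𝒱 → Path 𝒱 → Set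
  OnPath p (prop q)  = p ≡ q
  OnPath p (^ ρ)     = OnPath p ρ
  OnPath p (ρ₁ / ρ₂) = OnPath p ρ₁ ⊎ OnPath p ρ₂

  PropertyOccurs : Property 𝒱 → Constraint 𝒱 → Set
  PropertyOccurs p ⊤         = False
  PropertyOccurs p (shape s) = False
  PropertyOccurs p (node v)  = False
  PropertyOccurs p (φ ∧ ψ)   = PropertyOccurs p φ ⊎ PropertyOccurs p ψ
  PropertyOccurs p (¬ φ)     = PropertyOccurs p φ
  PropertyOccurs p (⩾ n ρ φ) = OnPath p ρ ⊎ PropertyOccurs p φ

record Shapes (𝒱 : Vocabulary) : Set₁ where
  field
    shapes : Pred (Shape 𝒱) 0ℓ

  Names : Pred (ShapeName 𝒱) 0ℓ
  Names s = ∃[ φ ] ∃[ q ] (s , φ , q) ∈ shapes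

  field
    closed : ∀ {s φ q} → (s , φ , q) ∈ shapes →
             ∀ {s′} → NameOccurs s′ φ → s′ ∈ Names

open Shapes

-- The interpretation I^{G,σ} gives `type` the empty extension, the edges
-- labelled `type` being represented by atomic concepts instead.  Constraints
-- must therefore not navigate along `type`: the shape (s, ⩾ 1 type ⊤, ⊥), for
-- one, admits faithful assignments that do not yield models.
TypeFree : {𝒱 : Vocabulary} → Shapes 𝒱 → Set
TypeFree {𝒱} S = ∀ {s φ q} → (s , φ , q) ∈ shapes S → Not (PropertyOccurs (type 𝒱) φ)

module _ {𝒱 : Vocabulary} where

  record Assignment (G : Graph 𝒱) (S : Shapes 𝒱) : Set₁ where
    field
      σ       : V G → Pred (ShapeName 𝒱) 0ℓ
      σ-names : ∀ v → σ v ⊆ Names S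

  open Assignment

  ⟦_⟧ᴾ : Path 𝒱 → Graph 𝒱 → Rel (Node 𝒱) 0ℓ
  ⟦ prop p ⟧ᴾ  G v₁ v₂ = E G (v₁ , p , v₂)
  ⟦ ^ ρ ⟧ᴾ     G v₂ v₁ = ⟦ ρ ⟧ᴾ G v₁ v₂
  ⟦ ρ₁ / ρ₂ ⟧ᴾ G v₁ v₂ = ∃[ v ] (⟦ ρ₁ ⟧ᴾ G v₁ v × ⟦ ρ₂ ⟧ᴾ G v v₂)

  ⟦_⟧ᶜ : Constraint 𝒱 → {G : Graph 𝒱} {S : Shapes 𝒱} → Assignment G S → Pred (V G) 0ℓ
  ⟦ ⊤ ⟧ᶜ       σG v = True
  ⟦ shape s ⟧ᶜ σG v = s ∈ σ σG v
  ⟦ node v′ ⟧ᶜ σG v = proj₁ v ≡ v′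
  ⟦ φ ∧ ψ ⟧ᶜ   σG v = ⟦ φ ⟧ᶜ σG v × ⟦ ψ ⟧ᶜ σG v
  ⟦ ¬ φ ⟧ᶜ     σG v = Not (⟦ φ ⟧ᶜ σG v)
  ⟦ ⩾ n ρ φ ⟧ᶜ {G} σG v =
    AtLeast n (λ w → ⟦ ρ ⟧ᴾ G (proj₁ v) (proj₁ w) × ⟦ φ ⟧ᶜ σG w)

  ⟦_⟧Q : Query 𝒱 → Graph 𝒱 → Pred (Node 𝒱) 0ℓ
  ⟦ ⊥ ⟧Q            G v  = False
  ⟦ oneOf vs ⟧Q     G v  = v ∈ᴸ vs
  ⟦ class c ⟧Q      G v  = E G (v , type 𝒱 , value c)
  ⟦ subjectsOf p ⟧Q G v₁ = ∃[ v₂ ] E G (v₁ , p , v₂)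
  ⟦ objectsOf p ⟧Q  G v₂ = ∃[ v₁ ] E G (v₁ , p , v₂)

  Faithful : {G : Graph 𝒱} {S : Shapes 𝒱} → Assignment G S → Set
  Faithful {G} {S} σG = ∀ {s φ q} → (s , φ , q) ∈ shapes S →
    (∀ v → (s ∈ σ σG v) ⇔ ⟦ φ ⟧ᶜ σG v) ×
    (∀ {v} → v ∈ ⟦ q ⟧Q G → ∃[ v∈G ] s ∈ σ σG (v , v∈G))

-- A signature is given by these sorts and a predicate 𝒪 on Object, whose
-- elements are the object names of the signature: they depend on the graph.
record NameSorts : Set₁ where
  field
    AtomicConcept  : Set
    AtomicProperty : Set
    Object         : Set

open NameSorts

module _ (𝒩 : NameSorts) where

  infixr 6 _⊓_
  infix  4 _⊑_ _≐_
  infixr 7 _∘_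

  data Role : Set where
    atomic : AtomicProperty 𝒩 → Role
    _⁻     : Role → Role
    _∘_    : Role → Role → Role

  data Concept : Set where
    atomic  : AtomicConcept 𝒩 → Concept
    nominal : List (Object 𝒩) → Concept
    ⊤       : Concept
    ¬_      : Concept → Concept
    _⊓_     : Concept → Concept → Concept
    ≥       : ℕ → Role → Concept → Concept

  data Axiom : Set where
    _⊑_ : Concept → Concept → Axiom

  KB : Set₁
  KB = Pred Axiom 0ℓ

  ⊥ᴰ : Concept
  ⊥ᴰ = ¬ ⊤

  ∃ᴰ : Role → Concept → Concept
  ∃ᴰ = ≥ 1

  _≐_ : Concept → Concept → List Axiom
  C ≐ D = (C ⊑ D) ∷ (D ⊑ C) ∷ []

module _ {𝒩 : NameSorts} where

  ObjectOccurs : Object 𝒩 → Concept 𝒩 → Set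
  ObjectOccurs o (atomic A)   = False
  ObjectOccurs o (nominal os) = o ∈ᴸ os
  ObjectOccurs o ⊤            = False
  ObjectOccurs o (¬ C)        = ObjectOccurs o C
  ObjectOccurs o (C ⊓ D)      = ObjectOccurs o C ⊎ ObjectOccurs o D
  ObjectOccurs o (≥ n r C)    = ObjectOccurs o C

  -- Every object name used in K belongs to 𝒪.
  _Over_ : KB 𝒩 → Pred (Object 𝒩) 0ℓ → Set
  K Over 𝒪 = ∀ {C D} → (C ⊑ D) ∈ K →
               ∀ {o} → ObjectOccurs o C ⊎ ObjectOccurs o D → o ∈ 𝒪

record Interpretation (𝒩 : NameSorts) (𝒪 : Pred (Object 𝒩) 0ℓ) : Set₁ where
  field
    Δ        : Set
    nonEmpty : Δ
    objectᴵ  : ∃ 𝒪 → Δ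
    conceptᴵ : AtomicConcept 𝒩 → Pred Δ 0ℓ
    roleᴵ    : AtomicProperty 𝒩 → Rel Δ 0ℓ

open Interpretation

module _ {𝒩 : NameSorts} {𝒪 : Pred (Object 𝒩) 0ℓ} (I : Interpretation 𝒩 𝒪) where

  ⟦_⟧ᴿ : Role 𝒩 → Rel (Δ I) 0ℓ
  ⟦ atomic p ⟧ᴿ     = roleᴵ I p
  ⟦ r ⁻ ⟧ᴿ          = flip ⟦ r ⟧ᴿ
  ⟦ r₁ ∘ r₂ ⟧ᴿ x z  = ∃[ y ] (⟦ r₁ ⟧ᴿ x y × ⟦ r₂ ⟧ᴿ y z)

  ⟦_⟧ᴰ : Concept 𝒩 → Pred (Δ I) 0ℓ
  ⟦ atomic A ⟧ᴰ     = conceptᴵ I A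
  -- For os over 𝒪 this is {o^I | o ∈ os}; I assigns nothing to other names.
  ⟦ nominal os ⟧ᴰ x = ∃[ o ] (proj₁ o ∈ᴸ os × objectᴵ I o ≡ x)
  ⟦ ⊤ ⟧ᴰ          x = True
  ⟦ ¬ C ⟧ᴰ        x = Not (⟦ C ⟧ᴰ x)
  ⟦ C ⊓ D ⟧ᴰ        = ⟦ C ⟧ᴰ ∩ ⟦ D ⟧ᴰ
  ⟦ ≥ n r C ⟧ᴰ    x = AtLeast n (λ y → ⟦ r ⟧ᴿ x y × ⟦ C ⟧ᴰ y)

  _⊨ᴬ_ : Axiom 𝒩 → Set
  _⊨ᴬ_ (C ⊑ D) = ⟦ C ⟧ᴰ ⊆ ⟦ D ⟧ᴰ

  _⊨_ : KB 𝒩 → Set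
  _⊨_ K = ∀ {α} → α ∈ K → _⊨ᴬ_ α

-- τ_name.  A class is also a node, and has both a concept name and an object name.
record Naming (𝒱 : Vocabulary) (𝒩 : NameSorts) : Set where
  field
    τ-concept : ShapeName 𝒱 ⊎ Class 𝒱 → AtomicConcept 𝒩
    τ-object  : Node 𝒱 → Object 𝒩
    τ-prop    : Property 𝒱 → AtomicProperty 𝒩
    τ-concept-injective : Injective _≡_ _≡_ τ-concept
    τ-object-injective  : Injective _≡_ _≡_ τ-object
    τ-prop-injective    : Injective _≡_ _≡_ τ-prop

  τ-shapeName : ShapeName 𝒱 → AtomicConcept 𝒩
  τ-shapeName s = τ-concept (inj₁ s)

  τ-class : Class 𝒱 → AtomicConcept 𝒩
  τ-class c = τ-concept (inj₂ c)

module _ {𝒱 : Vocabulary} {𝒩 : NameSorts} (τ : Naming 𝒱 𝒩) where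

  open Naming τ
  open Assignment

  τ-role : Path 𝒱 → Role 𝒩
  τ-role (prop p)  = atomic (τ-prop p)
  τ-role (^ ρ)     = τ-role ρ ⁻
  τ-role (ρ₁ / ρ₂) = τ-role ρ₁ ∘ τ-role ρ₂

  τ-constr : Constraint 𝒱 → Concept 𝒩
  τ-constr ⊤         = ⊤
  τ-constr (shape s) = atomic (τ-shapeName s)
  τ-constr (node v)  = nominal [ τ-object v ]
  τ-constr (φ ∧ ψ)   = τ-constr φ ⊓ τ-constr ψ
  τ-constr (¬ φ)     = ¬ τ-constr φ
  τ-constr (⩾ n ρ φ) = ≥ n (τ-role ρ) (τ-constr φ)

  τ-target : Query 𝒱 → Concept 𝒩
  τ-target ⊥              = ⊥ᴰ 𝒩
  τ-target (oneOf vs)     = nominal (List.map τ-object vs)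
  τ-target (class c)      = atomic (τ-class c)
  τ-target (subjectsOf p) = ∃ᴰ 𝒩 (atomic (τ-prop p)) ⊤
  τ-target (objectsOf p)  = ∃ᴰ 𝒩 (atomic (τ-prop p) ⁻) ⊤

  τ-shape : Shape 𝒱 → List (Axiom 𝒩)
  τ-shape (s , φ , q) =
    (τ-target q ⊑ atomic (τ-shapeName s)) ∷ _≐_ 𝒩 (τ-constr φ) (atomic (τ-shapeName s))

  τ-shapes : Shapes 𝒱 → KB 𝒩
  τ-shapes S α = ∃[ x ] (x ∈ shapes S × α ∈ᴸ τ-shape x)

  module _ (G : Graph 𝒱) where

    ObjectNames : Pred (Object 𝒩) 0ℓ
    ObjectNames o = ∃[ v ] (v ∈ᴸ nodes G × o ≡ τ-object v)

    τ-node : ∃ ObjectNames → V G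
    τ-node (_ , v , v∈G , _) = v , v∈G

  -- The inverse of τ_name on concept and property names is expressed by
  -- quantifying over preimages, which are unique; names without a preimage
  -- have empty extension.  An interpretation has a non-empty universe, so G
  -- must have a node v₀.
  interpretation : (G : Graph 𝒱) {S : Shapes 𝒱} → Assignment G S → V G →
                   Interpretation 𝒩 (ObjectNames G)
  interpretation G σG v₀ = record
    { Δ        = ∃ (ObjectNames G)
    ; nonEmpty = let (v , v∈G) = v₀ in τ-object v , v , v∈G , refl
    ; objectᴵ  = λ o → o
    ; conceptᴵ = λ A o →
        (∃[ c ] (A ≡ τ-class c × E G (proj₁ (τ-node G o) , type 𝒱 , value c))) ⊎
        (∃[ s ] (A ≡ τ-shapeName s × s ∈ σ σG (τ-node G o)))
    ; roleᴵ    = λ P o₁ o₂ →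
        ∃[ p ] (P ≡ τ-prop p × p ≢ type 𝒱 ×
                E G (proj₁ (τ-node G o₁) , p , proj₁ (τ-node G o₂)))
    }

{-# OPTIONS --safe #-}
module Submission where

open import Defs hiding (_∘_)
open import Data.Product using (_×_)

-- Typed edges are invisible to the roles of I^{G,σ}, but no constraint mentions
-- `type`, so I^{G,σ} and (G, σ) agree on every constraint and the axioms
-- τ(φ) ≡ τ(s) are clause (i) of faithfulness.  A target inclusion only needs
-- that the translated query selects no more than the query itself, which holds
-- even for subjectsOf type and objectsOf type; clause (ii) then applies.

open import Data.Fin using (Fin; zero; suc)
open import Data.List using (List; _∷_; length; lookup)
open import Data.List.Membership.Propositional using () renaming (_∈_ to _∈ᴸ_)
open import Data.List.Membership.Propositional.Properties using (∈-lookup; ∈-map⁻)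
open import Data.List.Membership.Propositional.Properties.WithK using (unique⇒irrelevant)
open import Data.List.Relation.Unary.Any using (here; there; index)
open import Data.Nat using (ℕ)
open import Data.Product using (∃; ∃-syntax; _,_; proj₁; proj₂; map₂)
open import Data.Product.Function.NonDependent.Propositional using (_×-⇔_)
open import Data.Sum using (inj₁; inj₂)
open import Function using (_∘_; _⇔_; Equivalence; Injective; _↔_; mk⇔; mk↔ₛ′)
open import Function.Construct.Composition using (_↔-∘_)
open import Function.Construct.Identity using (⇔-id)
open import Function.Related.TypeIsomorphisms using (¬-cong-⇔)
open import Level using (0ℓ)
open import Relation.Binary.PropositionalEquality
  using (_≡_; refl; sym; trans; cong; subst)
open import Relation.Nullary using () renaming (¬_ to Not)
open import Relation.Unary using (Pred; _∈_)

open Equivalence using (to; from)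

AtLeast-map : {X Y : Set} {n : ℕ} {P : Pred X 0ℓ} {Q : Pred Y 0ℓ} {g : X → Y} →
  Injective _≡_ _≡_ g → (∀ {x} → P x → Q (g x)) → AtLeast n P → AtLeast n Q
AtLeast-map {g = g} g-inj P⇒Q (f , f-inj , f∈P) =
  g ∘ f , f-inj ∘ g-inj , P⇒Q ∘ f∈P

private
  module _ {A : Set} where

    at : (xs : List A) → Fin (length xs) → ∃[ x ] x ∈ᴸ xs
    at xs i = lookup xs i , ∈-lookup i

    index-at : (xs : List A) (i : Fin (length xs)) → index (proj₂ (at xs i)) ≡ i
    index-at (x ∷ xs) zero    = refl
    index-at (x ∷ xs) (suc i) = cong suc (index-at xs i)

    at-index : {xs : List A} {x : A} (x∈xs : x ∈ᴸ xs) → at xs (index x∈xs) ≡ (x , x∈xs)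
    at-index (here refl)  = refl
    at-index (there x∈xs) = cong (map₂ there) (at-index x∈xs)

-- An element paired with a membership proof amounts to a position in `xs`, so a repeated entry
-- counts once per occurrence.
members↔Fin : {A : Set} (xs : List A) → (∃[ x ] x ∈ᴸ xs) ↔ Fin (length xs)
members↔Fin xs = mk↔ₛ′ (index ∘ proj₂) (at xs) (index-at xs) (at-index ∘ proj₂)

-- Paths run through arbitrary nodes, whereas the universe only holds names of nodes of `G`. This
-- places the middle node of a composite path in `V G`, so that it has a name there.
path-endpoints : {𝒱 : Vocabulary} (G : Graph 𝒱) (ρ : Path 𝒱) {v w : Vocabulary.Node 𝒱} →
  ⟦ ρ ⟧ᴾ G v w → v ∈ᴸ Graph.nodes G × w ∈ᴸ Graph.nodes G
path-endpoints G (prop p)  e = Graph.E-nodes G e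
path-endpoints G (^ ρ)     e = let (v∈G , w∈G) = path-endpoints G ρ e in w∈G , v∈G
path-endpoints G (ρ₁ / ρ₂) (_ , e₁ , e₂) =
  proj₁ (path-endpoints G ρ₁ e₁) , proj₂ (path-endpoints G ρ₂ e₂)

module _ {𝒱 : Vocabulary} {𝒩 : NameSorts} (τ : Naming 𝒱 𝒩) (G : Graph 𝒱) where

  open Naming τ

  nodeName : Graph.V G → ∃ (ObjectNames τ G)
  nodeName (v , v∈G) = τ-object v , v , v∈G , refl

  nodeName-τ-node : ∀ o → nodeName (τ-node τ G o) ≡ o
  nodeName-τ-node (_ , _ , _ , refl) = refl

  objectNames↔V : ∃ (ObjectNames τ G) ↔ Graph.V G
  objectNames↔V = mk↔ₛ′ (τ-node τ G) nodeName (λ _ → refl) nodeName-τ-node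

  τ-node-injective : Injective _≡_ _≡_ (τ-node τ G)
  τ-node-injective {o} {o′} eq =
    trans (sym (nodeName-τ-node o)) (trans (cong nodeName eq) (nodeName-τ-node o′))

  nodeName-injective : Injective _≡_ _≡_ nodeName
  nodeName-injective = cong (τ-node τ G)

  module _ {S : Shapes 𝒱} (σG : Assignment G S) (v₀ : Graph.V G) where

    open Vocabulary 𝒱 using (type; ShapeName; Node)
    open Assignment σG

    private
      I : Interpretation 𝒩 (ObjectNames τ G)
      I = interpretation τ G σG v₀

      Δ : Set
      Δ = Interpretation.Δ I

      ν : Δ → Graph.V G
      ν = τ-node τ G

    -- Avoiding `type` supplies the inequality demanded by `roleᴵ`; in the other direction,
    -- injectivity of `τ-prop` identifies the preimage chosen in `roleᴵ` with `p`.
    τ-role-⇔ : (ρ : Path 𝒱) → Not (OnPath type ρ) → (x y : Δ) →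
      ⟦ I ⟧ᴿ (τ-role τ ρ) x y ⇔ ⟦ ρ ⟧ᴾ G (proj₁ (ν x)) (proj₁ (ν y))
    τ-role-⇔ (prop p) p≢type x y = mk⇔ sound (λ e → p , refl , p≢type ∘ sym , e)
      where
      sound : ⟦ I ⟧ᴿ (τ-role τ (prop p)) x y → Graph.E G (proj₁ (ν x) , p , proj₁ (ν y))
      sound (q , eq , _ , e) with refl ← τ-prop-injective eq = e
    τ-role-⇔ (^ ρ) type∉ρ x y = τ-role-⇔ ρ type∉ρ y x
    τ-role-⇔ (ρ₁ / ρ₂) type∉ρ x y = mk⇔
      (λ (z , e₁ , e₂) → proj₁ (ν z) , to (left z) e₁ , to (right z) e₂)
      -- `ν z` computes back to `v` with its membership proof, so `e₁` and `e₂` fit without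
      -- transport.
      (λ (v , e₁ , e₂) → let z = nodeName (v , proj₁ (path-endpoints G ρ₂ e₂)) in
        z , from (left z) e₁ , from (right z) e₂)
      where
      left  = λ z → τ-role-⇔ ρ₁ (type∉ρ ∘ inj₁) x z
      right = λ z → τ-role-⇔ ρ₂ (type∉ρ ∘ inj₂) z y

    τ-shapeName-⇔ : (s : ShapeName) (x : Δ) → ⟦ I ⟧ᴰ (atomic (τ-shapeName s)) x ⇔ s ∈ σ (ν x)
    τ-shapeName-⇔ s x = mk⇔ sound (λ s∈σ → inj₂ (s , refl , s∈σ))
      where
      sound : ⟦ I ⟧ᴰ (atomic (τ-shapeName s)) x → s ∈ σ (ν x)
      -- Shape names and classes lie in different summands, so an injective `τ-concept` never gives
      -- them the same concept name.
      sound (inj₁ (_ , eq , _)) with () ← τ-concept-injective eq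
      sound (inj₂ (_ , eq , s∈σ)) with refl ← τ-concept-injective eq = s∈σ

    nominal-⇔ : (v : Node) (x : Δ) → ⟦ I ⟧ᴰ (τ-constr τ (node v)) x ⇔ proj₁ (ν x) ≡ v
    nominal-⇔ v x@(_ , _ , _ , refl) = mk⇔
      (λ { (_ , here eq , refl) → τ-object-injective eq })
      (λ { eq → x , here (cong τ-object eq) , refl })

    -- Both directions share one induction because negation exchanges them. Counting carries
    -- witnesses along `τ-node` one way and along `nodeName` the other, each injective.
    τ-constr-⇔ : (φ : Constraint 𝒱) → Not (PropertyOccurs type φ) → (x : Δ) →
      ⟦ I ⟧ᴰ (τ-constr τ φ) x ⇔ ⟦ φ ⟧ᶜ σG (ν x)
    τ-constr-⇔ ⊤         type∉φ x = ⇔-id _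
    τ-constr-⇔ (shape s) type∉φ x = τ-shapeName-⇔ s x
    τ-constr-⇔ (node v)  type∉φ x = nominal-⇔ v x
    τ-constr-⇔ (φ ∧ ψ)   type∉φ x =
      τ-constr-⇔ φ (type∉φ ∘ inj₁) x ×-⇔ τ-constr-⇔ ψ (type∉φ ∘ inj₂) x
    τ-constr-⇔ (¬ φ)     type∉φ x = ¬-cong-⇔ (τ-constr-⇔ φ type∉φ x)
    τ-constr-⇔ (⩾ n ρ φ) type∉φ x = mk⇔
      (AtLeast-map τ-node-injective (λ {y} → to (eq y)))
      (AtLeast-map {Q = λ y → ⟦ I ⟧ᴿ (τ-role τ ρ) x y × ⟦ I ⟧ᴰ (τ-constr τ φ) y}
        nodeName-injective (λ {w} → from (eq (nodeName w))))
      where eq = λ y → τ-role-⇔ ρ (type∉φ ∘ inj₁) x y ×-⇔ τ-constr-⇔ φ (type∉φ ∘ inj₂) y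

    -- The edge behind a role is kept and its inequality with `type` dropped. The converse fails for
    -- `subjectsOf type` once `G` has an edge labelled `type`, since the corresponding role is
    -- empty.
    τ-target-sound : (q : Query 𝒱) (x : Δ) →
      ⟦ I ⟧ᴰ (τ-target τ q) x → proj₁ (ν x) ∈ ⟦ q ⟧Q G
    τ-target-sound ⊥ x ¬⊤ = ¬⊤ _
    τ-target-sound (oneOf vs) (_ , _ , _ , refl) (_ , τv∈vs , refl)
      with _ , w∈vs , eq ← ∈-map⁻ τ-object τv∈vs
      with refl ← τ-object-injective eq = w∈vs
    τ-target-sound (class c) x (inj₁ (_ , eq , e))
      with refl ← τ-concept-injective eq = e
    τ-target-sound (class c) x (inj₂ (_ , eq , _)) with () ← τ-concept-injective eq
    τ-target-sound (subjectsOf p) x (f , _ , f∈)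
      -- The existential is `≥ 1`, whose single witness has index `zero`.
      with (_ , eq , _ , e) , _ ← f∈ zero
      with refl ← τ-prop-injective eq = _ , e
    τ-target-sound (objectsOf p) x (f , _ , f∈)
      with (_ , eq , _ , e) , _ ← f∈ zero
      with refl ← τ-prop-injective eq = _ , e

    interpretation-⊨ : Faithful σG → TypeFree S → I ⊨ τ-shapes τ S
    interpretation-⊨ faithful typeFree ((s , φ , q) , s∈S , here refl) {x} x∈q =
      let (v∈G , s∈σ) = proj₂ (faithful s∈S) (τ-target-sound q x x∈q)
          -- `σ` takes a node together with its membership proof, and the proof from clause (ii)
          -- need not be the one stored in `x`; the list being repetition-free makes them equal.
          irrelevant  = unique⇒irrelevant (Graph.unique G)
      in from (τ-shapeName-⇔ s x)
           (subst (λ p → s ∈ σ (proj₁ (ν x) , p)) (irrelevant v∈G (proj₂ (ν x))) s∈σ)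
    interpretation-⊨ faithful typeFree ((s , φ , q) , s∈S , there (here refl)) {x} =
      from (τ-shapeName-⇔ s x) ∘ from (proj₁ (faithful s∈S) (ν x)) ∘
      to (τ-constr-⇔ φ (typeFree s∈S) x)
    interpretation-⊨ faithful typeFree ((s , φ , q) , s∈S , there (there (here refl))) {x} =
      from (τ-constr-⇔ φ (typeFree s∈S) x) ∘ to (proj₁ (faithful s∈S) (ν x)) ∘
      to (τ-shapeName-⇔ s x)

theorem1 : {𝒱 : Vocabulary} {𝒩 : NameSorts} (τ : Naming 𝒱 𝒩)
    (S : Shapes 𝒱) (G : Graph 𝒱) (v₀ : Graph.V G) (σ : Assignment G S) →
    Faithful σ →
    TypeFree S →
    τ-shapes τ S Over ObjectNames τ G →
    Finite (Interpretation.Δ (interpretation τ G σ v₀)) ×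
    (interpretation τ G σ v₀ ⊨ τ-shapes τ S)
theorem1 τ S G v₀ σ faithful typeFree _ =
  -- The universe is in bijection with `V G`, so its size is the length of the node list.
  (_ , members↔Fin (Graph.nodes G) ↔-∘ objectNames↔V τ G) ,
  interpretation-⊨ τ G σ v₀ faithful typeFree
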